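{- Let $k \geq 1$ be an integer. For all graphs $G_1, G_2$, $$\alpha_k(G_1 \times G_2) \geq \alpha_k(G_1) \cdot \alpha_k(G_2).$$
   Context: Graphs are finite, simple and undirected. For a graph $G$, $\delta_G(u,v)$ is the length of a shortest path between vertices $u$ and $v$ in $G$ (equal to $\infty$ if there is none). A set $S \subseteq V(G)$ is $k$-independent if $\delta_G(u,v) > k$ for all distinct $u,v \in S$; $\alpha_k(G)$ denotes the maximum size of a $k$-independent set in $G$. The tensor product $G_1 \times G_2$ has vertex set $V(G_1)\times V(G_2)$, and $(u_1,u_2),(v_1,v_2)$ are adjacent if and only if $(u_1,v_1)\in E(G_1)$ and $(u_2,v_2)\in E(G_2)$. -}

module Defs where

open import Data.Fin using (Fin)
open import Data.Fin.Properties using (any?; inj⇒≟; injective⇒≤; *↔×)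
open import Data.List using (List; []; _∷_; length; lookup)
open import Data.List.Membership.Propositional using (_∈_)
open import Data.List.Membership.Propositional.Properties using (∈-lookup)
open import Data.List.Relation.Unary.All as All using (all?)
open import Data.List.Relation.Unary.AllPairs using ([]; _∷_)
open import Data.List.Relation.Unary.Unique.Propositional using (Unique)
import Data.List.Relation.Unary.Unique.DecPropositional as DecUnique
open import Data.Nat using (ℕ; zero; suc; _*_; _≤_; _<_; z≤n; s≤s⁻¹)
open import Data.Nat.Properties using (_<?_; ≤⇒≯; ≤∧≢⇒<; suc-injective)
open import Data.Product using (∃; ∃-syntax; Σ; _×_; _,_; proj₁)
open import Data.Product.Function.NonDependent.Propositional using (_×-↔_)
open import Data.Sum using (_⊎_; inj₁; inj₂)
open import Function using (_∘_; _↔_; Inverse)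
open import Function.Construct.Composition using (_↔-∘_)
open import Function.Construct.Symmetry using (↔-sym)
open import Function.Properties.Inverse using (↔⇒↣)
open import Level using (0ℓ)
open import Relation.Binary using (Rel; Decidable; DecidableEquality; Symmetric; Irreflexive)
open import Relation.Binary.Construct.Add.Supremum.Strict _<_ using (_<⁺_; <⁺-dec)
open import Relation.Binary.PropositionalEquality
  using (_≡_; _≢_; refl; sym; trans; cong; subst)
open import Relation.Nullary using (¬_; Dec; yes; no; contradiction)
open import Relation.Nullary.Construct.Add.Supremum using (_⁺; [_]; ⊤⁺)
open import Relation.Nullary.Decidable using (map′; ¬?; _×-dec_; _→-dec_)
import Relation.Unary as U

record Graph : Set₁ where
  field
    Vertex      : Set
    order       : ℕ
    enumeration : Vertex ↔ Fin order
    Adj         : Rel Vertex 0ℓ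
    -- Classically no restriction; it makes distances and α computable.
    adj?        : Decidable Adj
    symmetric   : Symmetric Adj
    irreflexive : Irreflexive _≡_ Adj

infixr 7 _×ᵗ_

_×ᵗ_ : Graph → Graph → Graph
G₁ ×ᵗ G₂ = record
  { Vertex      = G₁.Vertex × G₂.Vertex
  ; order       = G₁.order * G₂.order
  ; enumeration = ↔-sym *↔× ↔-∘ (G₁.enumeration ×-↔ G₂.enumeration)
  ; Adj         = λ (u₁ , u₂) (v₁ , v₂) → G₁.Adj u₁ v₁ × G₂.Adj u₂ v₂
  ; adj?        = λ (u₁ , u₂) (v₁ , v₂) → G₁.adj? u₁ v₁ ×-dec G₂.adj? u₂ v₂
  ; symmetric   = λ (e₁ , e₂) → G₁.symmetric e₁ , G₂.symmetric e₂
  ; irreflexive = λ u≡v (e₁ , _) → G₁.irreflexive (cong proj₁ u≡v) e₁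
  }
  where
  module G₁ = Graph G₁
  module G₂ = Graph G₂

module _ {P : U.Pred ℕ 0ℓ} (P? : U.Decidable P) where

  least : ∀ n → (∃[ m ] P m × (∀ {j} → P j → m ≤ j)) ⊎ (∀ {j} → P j → n ≤ j)
  least zero = inj₂ λ _ → z≤n
  least (suc n) with least n
  ... | inj₁ found = inj₁ found
  ... | inj₂ n≤ with P? n
  ...   | yes Pn = inj₁ (n , Pn , n≤)
  ...   | no ¬Pn = inj₂ λ Pj → ≤∧≢⇒< (n≤ Pj) λ { refl → ¬Pn Pj }

  greatest : P 0 → ∀ n → (∀ {j} → P j → j ≤ n) → ∃[ m ] P m × (∀ {j} → P j → j ≤ m)
  greatest P0 zero ≤n = 0 , P0 , ≤n
  greatest P0 (suc n) ≤n with P? (suc n)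
  ... | yes Pn = suc n , Pn , ≤n
  ... | no ¬Pn = greatest P0 n λ Pj → s≤s⁻¹ (≤∧≢⇒< (≤n Pj) λ { refl → ¬Pn Pj })

lookup-injective : ∀ {A : Set} {xs : List A} → Unique xs →
                   ∀ {i j} → lookup xs i ≡ lookup xs j → i ≡ j
lookup-injective (_ ∷ _)  {Fin.zero}  {Fin.zero}  _ = refl
lookup-injective (x∉ ∷ _) {Fin.zero}  {Fin.suc j} p =
  contradiction p (All.lookup x∉ (∈-lookup j))
lookup-injective (x∉ ∷ _) {Fin.suc i} {Fin.zero}  p =
  contradiction (sym p) (All.lookup x∉ (∈-lookup i))
lookup-injective (_ ∷ xs!) {Fin.suc i} {Fin.suc j} p =
  cong Fin.suc (lookup-injective xs! p)

module _ (G : Graph) where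

  open Graph G

  _≟_ : DecidableEquality Vertex
  _≟_ = inj⇒≟ (↔⇒↣ enumeration)

  anyVertex? : ∀ {P : U.Pred Vertex 0ℓ} → U.Decidable P → Dec (∃ P)
  anyVertex? {P} P? = map′
    (λ (i , p) → from i , p)
    (λ (v , p) → to v , subst P (sym (strictlyInverseʳ v)) p)
    (any? (P? ∘ from))
    where open Inverse enumeration

  Unique⇒length≤order : ∀ {vs} → Unique vs → length vs ≤ order
  Unique⇒length≤order vs! = injective⇒≤ (lookup-injective vs! ∘ to-inj)
    where
    open Inverse enumeration
    to-inj : ∀ {u v} → to u ≡ to v → u ≡ v
    to-inj {u} {v} p =
      trans (sym (strictlyInverseʳ u)) (trans (cong from p) (strictlyInverseʳ v))

  data Walk : Vertex → Vertex → ℕ → Set where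
    []  : ∀ {u} → Walk u u 0
    _∷_ : ∀ {u v w n} → Adj u v → Walk v w n → Walk u w (suc n)

  vertices : ∀ {u v n} → Walk u v n → List Vertex
  vertices {u} []      = u ∷ []
  vertices {u} (_ ∷ w) = u ∷ vertices w

  Path : Vertex → Vertex → ℕ → Set
  Path u v n = Σ (Walk u v n) (Unique ∘ vertices)

  data IsDistance (u v : Vertex) : ℕ ⁺ → Set where
    finite   : ∀ {m} → Path u v m → (∀ {n} → Path u v n → m ≤ n) → IsDistance u v [ m ]
    infinite : (∀ {n} → ¬ Path u v n) → IsDistance u v ⊤⁺

  walk? : ∀ {P : U.Pred (List Vertex) 0ℓ} → U.Decidable P →
          ∀ n u v → Dec (Σ (Walk u v n) (P ∘ vertices))
  walk? P? zero u v = map′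
    (λ { (refl , p) → [] , p }) (λ { ([] , p) → refl , p })
    ((u ≟ v) ×-dec P? (u ∷ []))
  walk? P? (suc n) u v = map′
    (λ (_ , e , w , p) → e ∷ w , p) (λ { (e ∷ w , p) → _ , e , w , p })
    (anyVertex? λ x → adj? u x ×-dec walk? (P? ∘ (u ∷_)) n x v)

  path? : ∀ u v → U.Decidable (Path u v)
  path? u v n = walk? (DecUnique.unique? _≟_) n u v

  length-vertices : ∀ {u v n} (w : Walk u v n) → length (vertices w) ≡ suc n
  length-vertices []      = refl
  length-vertices (_ ∷ w) = cong suc (length-vertices w)

  path-bound : ∀ {u v n} → Path u v n → n < order
  path-bound (w , w!) = subst (_≤ order) (length-vertices w) (Unique⇒length≤order w!)

  distance : ∀ u v → ∃ (IsDistance u v)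
  distance u v with least (path? u v) order
  ... | inj₁ (m , p , m≤) = [ m ] , finite p m≤
  ... | inj₂ order≤       = ⊤⁺ , infinite λ p → contradiction (path-bound p) (≤⇒≯ (order≤ p))

  δ : Vertex → Vertex → ℕ ⁺
  δ u v = proj₁ (distance u v)

  -- A finite set of vertices is given by a duplicate-free list of its elements,
  -- so that its size is the length of the list.
  record Independent (k : ℕ) (S : List Vertex) : Set where
    constructor independent
    field
      unique : Unique S
      far    : ∀ {u v} → u ∈ S → v ∈ S → u ≢ v → [ k ] <⁺ δ u v

  independent? : ∀ k → U.Decidable (Independent k)
  independent? k S = map′
    (λ (S! , h) → independent S! λ u∈S v∈S → All.lookup (All.lookup h u∈S) v∈S)
    (λ I → Independent.unique I ,
           All.tabulate λ u∈S → All.tabulate λ v∈S → Independent.far I u∈S v∈S)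
    (DecUnique.unique? _≟_ S ×-dec
     all? (λ u → all? (λ v → ¬? (u ≟ v) →-dec <⁺-dec _<?_ [ k ] (δ u v)) S) S)

  IndependentOfSize : ℕ → ℕ → Set
  IndependentOfSize k n = ∃[ S ] Independent k S × length S ≡ n

  listOfLength? : ∀ {P : U.Pred (List Vertex) 0ℓ} → U.Decidable P →
                  ∀ n → Dec (∃[ S ] P S × length S ≡ n)
  listOfLength? P? zero = map′
    (λ p → [] , p , refl) (λ { ([] , p , refl) → p })
    (P? [])
  listOfLength? P? (suc n) = map′
    (λ (v , S , p , eq) → v ∷ S , p , cong suc eq)
    (λ { (v ∷ S , p , eq) → v , S , p , suc-injective eq })
    (anyVertex? λ v → listOfLength? (P? ∘ (v ∷_)) n)

  IsMaximumSize : ℕ → ℕ → Set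
  IsMaximumSize k m =
    IndependentOfSize k m × (∀ {n} → IndependentOfSize k n → n ≤ m)

  maximumSize : ∀ k → ∃ (IsMaximumSize k)
  maximumSize k = greatest (listOfLength? (independent? k))
    ([] , independent [] (λ ()) , refl)
    order
    λ (_ , I , eq) → subst (_≤ order) eq (Unique⇒length≤order (Independent.unique I))

α : ℕ → Graph → ℕ
α k G = proj₁ (maximumSize G k)

{-# OPTIONS --safe #-}

-- The product of k-independent sets S₁ ⊆ V(G₁) and S₂ ⊆ V(G₂) is k-independent
-- in G₁ × G₂: two distinct pairs differ in some coordinate, and a walk between
-- them projects to a walk of the same length in that coordinate, which is
-- longer than k because shortcutting its cycles leaves a path longer than k.
module Submission where

open import Defs using (Graph; _×ᵗ_; α)
open import Defs using (Walk; []; _∷_; Path; vertices; finite; infinite; _≟_; distance; δ)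
open import Defs using (Independent; independent; maximumSize)
open import Data.List using (List; []; _∷_; map; length; cartesianProduct)
open import Data.List.Membership.Propositional using (_∈_)
open import Data.List.Membership.Propositional.Properties using (∈-cartesianProduct⁻)
import Data.List.Membership.DecPropositional as DecMembership
open import Data.List.Properties using (length-++; length-map)
open import Data.List.Relation.Unary.All.Properties.Core using (¬Any⇒All¬)
open import Data.List.Relation.Unary.AllPairs using ([]; _∷_)
open import Data.List.Relation.Unary.All using ([])
open import Data.List.Relation.Unary.Any using (here; there)
open import Data.List.Relation.Unary.Unique.Propositional.Properties using (cartesianProduct⁺)
open import Data.Nat using (ℕ; suc; _+_; _*_; _≥_; _≤_; _<_; z≤n; s≤s)
open import Data.Nat.Properties using (≤-refl; ≤-trans; <-≤-trans; m≤n⇒m≤1+n)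
open import Data.Product using (∃-syntax; _×_; _,_; proj₁; proj₂)
open import Relation.Binary.Construct.Add.Supremum.Strict _<_ using (_<⁺_; [_]; [_]<⊤⁺)
open import Relation.Binary.PropositionalEquality using (_≡_; _≢_; refl; trans; cong₂)
open import Relation.Nullary using (yes; no; contradiction)
open import Relation.Nullary.Construct.Add.Supremum using ([_])

length-cartesianProduct : ∀ {A B : Set} (xs : List A) (ys : List B) →
                          length (cartesianProduct xs ys) ≡ length xs * length ys
length-cartesianProduct []       ys = refl
length-cartesianProduct (x ∷ xs) ys =
  trans (length-++ (map (x ,_) ys))
        (cong₂ _+_ (length-map (x ,_) ys) (length-cartesianProduct xs ys))

module _ (G : Graph) where

  open DecMembership (_≟_ G) using (_∈?_)

  -- A tail of a duplicate-free list is duplicate-free, so what remains after dropping the vertices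
  -- before `u` is still a path. This is the cut that removes a cycle in `walk⇒path`.
  suffix-path : ∀ {u v w n} (p : Path G v w n) → u ∈ vertices G (proj₁ p) →
                ∃[ m ] m ≤ n × Path G u w m
  suffix-path p@([] , _)    (here refl) = _ , ≤-refl , p
  suffix-path p@(_ ∷ _ , _) (here refl) = _ , ≤-refl , p
  suffix-path (_ ∷ w , _ ∷ w!) (there u∈) =
    let m , m≤n , p = suffix-path (w , w!) u∈ in m , m≤n⇒m≤1+n m≤n , p

  -- Induction on the walk: shorten the tail first, then prepend `u`; if `u` already lies on the
  -- shortened tail, its suffix from `u` is used instead.
  walk⇒path : ∀ {u v n} → Walk G u v n → ∃[ m ] m ≤ n × Path G u v m
  walk⇒path [] = 0 , z≤n , [] , [] ∷ []
  walk⇒path {u} (e ∷ w) with walk⇒path w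
  ... | m , m≤n , p , p! with u ∈? vertices G p
  ...   | no u∉ = suc m , s≤s m≤n , e ∷ p , ¬Any⇒All¬ _ u∉ ∷ p!
  ...   | yes u∈ =
    let l , l≤m , q = suffix-path (p , p!) u∈ in l , m≤n⇒m≤1+n (≤-trans l≤m m≤n) , q

  -- `δ` is minimal among paths only, so the walk is first cut down to a path, which is no longer
  -- than the walk.
  far⇒long-walks : ∀ {k u v} → [ k ] <⁺ δ G u v → ∀ {n} → Walk G u v n → k < n
  far⇒long-walks {u = u} {v} k<δ w with distance G u v | k<δ | walk⇒path w
  ... | _ , finite _ min    | [ k<d ] | m , m≤n , p = <-≤-trans k<d (≤-trans (min p) m≤n)
  ... | _ , infinite noPath | _       | m , m≤n , p = contradiction p noPath

  -- A shortest path is itself a walk, so this direction requires no shortcutting.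
  long-walks⇒far : ∀ {k u v} → (∀ {n} → Walk G u v n → k < n) → [ k ] <⁺ δ G u v
  long-walks⇒far {u = u} {v} long with distance G u v
  ... | _ , finite (w , _) _ = [ long w ]
  ... | _ , infinite _       = [ _ ]<⊤⁺

module _ (G₁ G₂ : Graph) where

  -- Every edge of the tensor product moves along an edge in both coordinates, so the length is
  -- kept; vertices may repeat, so a path can project to a mere walk.
  proj₁-walk : ∀ {u v n} → Walk (G₁ ×ᵗ G₂) u v n → Walk G₁ (proj₁ u) (proj₁ v) n
  proj₁-walk []            = []
  proj₁-walk ((e , _) ∷ w) = e ∷ proj₁-walk w

  proj₂-walk : ∀ {u v n} → Walk (G₁ ×ᵗ G₂) u v n → Walk G₂ (proj₂ u) (proj₂ v) n
  proj₂-walk []            = []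
  proj₂-walk ((_ , e) ∷ w) = e ∷ proj₂-walk w

  cartesianProduct-independent :
    ∀ {k S₁ S₂} → Independent G₁ k S₁ → Independent G₂ k S₂ →
    Independent (G₁ ×ᵗ G₂) k (cartesianProduct S₁ S₂)
  cartesianProduct-independent {k} {S₁} {S₂} (independent S₁! far₁) (independent S₂! far₂) =
    independent (cartesianProduct⁺ S₁! S₂!) far
    where
    far : ∀ {u v} → u ∈ cartesianProduct S₁ S₂ → v ∈ cartesianProduct S₁ S₂ →
          u ≢ v → [ k ] <⁺ δ (G₁ ×ᵗ G₂) u v
    far {u₁ , u₂} {v₁ , v₂} u∈ v∈ u≢v
      with ∈-cartesianProduct⁻ S₁ S₂ u∈ | ∈-cartesianProduct⁻ S₁ S₂ v∈
    ... | u₁∈ , u₂∈ | v₁∈ , v₂∈ = long-walks⇒far (G₁ ×ᵗ G₂) long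
      where
      long : ∀ {n} → Walk (G₁ ×ᵗ G₂) (u₁ , u₂) (v₁ , v₂) n → k < n
      long w with _≟_ G₁ u₁ v₁
      ... | no u₁≢v₁ = far⇒long-walks G₁ (far₁ u₁∈ v₁∈ u₁≢v₁) (proj₁-walk w)
      -- Here the projection to `G₁` is closed and gives no bound, but the second coordinates must
      -- differ.
      ... | yes u₁≡v₁ =
        far⇒long-walks G₂ (far₂ u₂∈ v₂∈ λ u₂≡v₂ → u≢v (cong₂ _,_ u₁≡v₁ u₂≡v₂)) (proj₂-walk w)

theorem4p3 : (k : ℕ) → k ≥ 1 → (G₁ G₂ : Graph) →
    α k (G₁ ×ᵗ G₂) ≥ α k G₁ * α k G₂
theorem4p3 k _ G₁ G₂ =
  -- Each `α` is by definition the first component of `maximumSize`, so `S₁` and `S₂` attain the two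
  -- factors and `maximal` bounds by the left side of the goal.
  let _ , (S₁ , I₁ , |S₁|≡α) , _ = maximumSize G₁ k
      _ , (S₂ , I₂ , |S₂|≡α) , _ = maximumSize G₂ k
      _ , _ , maximal            = maximumSize (G₁ ×ᵗ G₂) k
  in maximal (cartesianProduct S₁ S₂ , cartesianProduct-independent G₁ G₂ I₁ I₂ ,
              trans (length-cartesianProduct S₁ S₂) (cong₂ _*_ |S₁|≡α |S₂|≡α))
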